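{- Let $\langle A,\to\rangle$ be a conditional algebra. Then $\langle A,\to\rangle$ is a pseudo-subordination algebra (i.e., additionally satisfies $0\to a=1$ and $(a\to c)\wedge(b\to c)\le(a\vee b)\to c$ for all $a,b,c$) if and only if $T_A$ satisfies: for all ultrafilters $u,v$ and all $Y$, if $T_A(u,Y,v)$ then there exists $w\in Y$ such that $T_A(u,\{w\},v)$.
   Context: A conditional algebra is $\langle A,\to\rangle$ with $A$ a Boolean algebra and $\to$ binary with $a\to1=1$, $(a\to b)\wedge(a\to c)=a\to(b\wedge c)$, $(a\vee b)\to c\le(a\to c)\wedge(b\to c)$. Filters include the improper filter $A$; for a filter $F$, $\varphi(F)=\{u\in\mathrm{Ul}(A):F\subseteq u\}$ (so $\varphi(A)=\emptyset$). $D^{\to}_u(F)=\{b:\exists a\in F,\ a\to b\in u\}$; $T_A(u,Z,v)$ iff there is a filter $F$ with $Z=\varphi(F)$ and $D^{\to}_u(F)\subseteq v$. -}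

module Defs where

open import Level using (suc; _⊔_)
open import Algebra.Core using (Op₂)
open import Algebra.Definitions using (Congruent₂)
open import Algebra.Lattice.Bundles using (BooleanAlgebra)
import Algebra.Lattice.Properties.BooleanAlgebra as BooleanAlgebraProperties
open import Data.Product.Base using (∃-syntax; _×_)
open import Relation.Binary.Bundles using (Poset)
open import Relation.Unary using (Pred; _∈_; _∉_; _⊆_; _≐_)

record ConditionalAlgebra c ℓ : Set (suc (c ⊔ ℓ)) where
  infixr 5 _⇒_
  field
    booleanAlgebra : BooleanAlgebra c ℓ

  open BooleanAlgebra booleanAlgebra public hiding (¬_)

  -- The natural order of the lattice reduct: x ≤ y means x ≈ x ∧ y.
  open Poset (BooleanAlgebraProperties.poset booleanAlgebra) public using (_≤_)

  field
    _⇒_        : Op₂ Carrier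
    ⇒-cong     : Congruent₂ _≈_ _⇒_
    ⇒-⊤        : ∀ a → a ⇒ ⊤ ≈ ⊤
    ⇒-∧        : ∀ a b c → (a ⇒ b) ∧ (a ⇒ c) ≈ a ⇒ (b ∧ c)
    ∨-⇒        : ∀ a b c → (a ∨ b) ⇒ c ≤ (a ⇒ c) ∧ (b ⇒ c)

record IsPseudoSubordination {c ℓ} (𝐀 : ConditionalAlgebra c ℓ) : Set (c ⊔ ℓ) where
  open ConditionalAlgebra 𝐀
  field
    ⊥-⇒   : ∀ a → ⊥ ⇒ a ≈ ⊤
    ⇒-∨   : ∀ a b c → (a ⇒ c) ∧ (b ⇒ c) ≤ (a ∨ b) ⇒ c

module _ {c ℓ} (𝐀 : ConditionalAlgebra c ℓ) where
  open ConditionalAlgebra 𝐀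

  -- The improper filter is allowed.
  record Filter : Set (suc (c ⊔ ℓ)) where
    field
      set      : Pred Carrier (c ⊔ ℓ)
      ⊤-closed : ⊤ ∈ set
      ↑-closed : ∀ {a b} → a ≤ b → a ∈ set → b ∈ set
      ∧-closed : ∀ {a b} → a ∈ set → b ∈ set → a ∧ b ∈ set

  Proper : Filter → Set (c ⊔ ℓ)
  Proper F = ⊥ ∉ Filter.set F

  record Ultrafilter : Set (suc (c ⊔ ℓ)) where
    field
      filter  : Filter
      proper  : Proper filter
      maximal : ∀ (G : Filter) → Proper G →
                Filter.set filter ⊆ Filter.set G → Filter.set G ⊆ Filter.set filter

    open Filter filter public

  open Filter using () renaming (set to ⟦_⟧)
  open Ultrafilter using () renaming (set to ⟦_⟧ᵘ)

  φ : Filter → Pred Ultrafilter (c ⊔ ℓ)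
  φ F u = ⟦ F ⟧ ⊆ ⟦ u ⟧ᵘ

  -- Ultrafilters are identified when they have the same elements.
  ｛_｝ : Ultrafilter → Pred Ultrafilter (c ⊔ ℓ)
  ｛ w ｝ v = ⟦ w ⟧ᵘ ≐ ⟦ v ⟧ᵘ

  D : Ultrafilter → Filter → Pred Carrier (c ⊔ ℓ)
  D u F b = ∃[ a ] (a ∈ ⟦ F ⟧ × a ⇒ b ∈ ⟦ u ⟧ᵘ)

  T : Ultrafilter → Pred Ultrafilter (c ⊔ ℓ) → Ultrafilter → Set (suc (c ⊔ ℓ))
  T u Z v = ∃[ F ] (Z ≐ φ F × D u F ⊆ ⟦ v ⟧ᵘ)

{-# OPTIONS --safe #-}

-- From left to right: if D_u(F) ⊆ v, then I = {a : a ⇒ b ∈ u for some b ∉ v} is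
-- disjoint from F, and the two extra axioms make I an ideal; an
-- ultrafilter w ⊇ F disjoint from I is the required point.
-- From right to left: if e ⇒ c ∉ u, then some v with c ∉ v satisfies T(u, φ(↑e), v).
-- For e = ⊥ the set φ(↑e) is empty, which gives the first axiom. For e = a ∨ b the
-- point w contains a or b, and so does every filter G with φ(G) = {w}; hence not both
-- a ⇒ c and b ⇒ c are in u.
-- The separation of filters from ideals rests on Zorn's lemma.
module Submission where

open import Defs
import Algebra.Lattice.Properties.BooleanAlgebra as BooleanAlgebraProperties
open import Axiom.ExcludedMiddle using (ExcludedMiddle)
open import Axiom.Extensionality.Propositional using (Extensionality)
open import Data.Bool.Base using (Bool; true; false) renaming (T to IsTrue)
open import Data.Empty using (⊥-elim)
open import Data.Product.Base using (∃-syntax; _×_; _,_; proj₁; proj₂)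
open import Data.Sum.Base using (_⊎_; inj₁; inj₂; [_,_])
open import Data.Unit.Base using (tt)
open import Function.Base using (_∘_; id)
open import Function.Bundles using (_⇔_; mk⇔)
open import Level using (_⊔_; Lift; lift) renaming (suc to lsuc)
import Relation.Binary.Lattice.Bundles as Order
open import Relation.Nullary using (¬_; yes; no)
open import Relation.Nullary.Decidable using (isYes; toWitness; fromWitness; decidable-stable)
open import Relation.Unary using (Pred; _∈_; _∉_; _⊆_; _≐_; _∪_)

-- Zorn's lemma

module Zorn (em : ∀ {a} → ExcludedMiddle a) (ext : ∀ {a b} → Extensionality a b)
            {a} {A : Set a} where

  open import Relation.Binary.PropositionalEquality.Core using (_≡_; refl)

  -- Bool-valued subsets keep the powerset in the universe of A and are equal as
  -- soon as they have the same elements.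
  Subset : Set a
  Subset = A → Bool

  infix 4 _⊑_ _∈ˢ_

  _∈ˢ_ : A → Subset → Set
  z ∈ˢ x = IsTrue (x z)

  _⊑_ : Subset → Subset → Set a
  x ⊑ y = ∀ z → z ∈ˢ x → z ∈ˢ y

  compr : ∀ {p} → Pred A p → Subset
  compr P z = isYes (em {P = P z})

  ∈-compr⁺ : ∀ {p} (P : Pred A p) {z} → P z → z ∈ˢ compr P
  ∈-compr⁺ P = fromWitness

  ∈-compr⁻ : ∀ {p} (P : Pred A p) {z} → z ∈ˢ compr P → P z
  ∈-compr⁻ P = toWitness

  ⊑-trans : ∀ {x y z} → x ⊑ y → y ⊑ z → x ⊑ z
  ⊑-trans p q w = q w ∘ p w

  -- Equality rather than mutual inclusion is wanted because the function iterated below is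
  -- arbitrary: only `x ≡ y` makes `f x` and `f y` agree.
  ⊑-antisym : ∀ {x y} → x ⊑ y → y ⊑ x → x ≡ y
  ⊑-antisym {x} {y} p q = ext λ z → bool (x z) (y z) (p z) (q z)
    where
    bool : ∀ b c → (IsTrue b → IsTrue c) → (IsTrue c → IsTrue b) → b ≡ c
    bool true  true  _ _ = refl
    bool false false _ _ = refl
    bool true  false f _ = ⊥-elim (f tt)
    bool false true  _ g = ⊥-elim (g tt)

  Family : Set a
  Family = Subset → Bool

  Covered : Family → Pred A a
  Covered S z = ∃[ s ] (IsTrue (S s) × z ∈ˢ s)

  ⋃ : Family → Subset
  ⋃ S = compr (Covered S)

  ∈-⋃⁻ : ∀ S {z} → z ∈ˢ ⋃ S → Covered S z
  ∈-⋃⁻ S = ∈-compr⁻ (Covered S)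

  ⋃-upper : ∀ S {s} → IsTrue (S s) → s ⊑ ⋃ S
  ⋃-upper S s∈S z z∈s = ∈-compr⁺ (Covered S) (_ , s∈S , z∈s)

  ⋃-least : ∀ S {y} → (∀ s → IsTrue (S s) → s ⊑ y) → ⋃ S ⊑ y
  ⋃-least S h z z∈ with ∈-⋃⁻ S z∈
  ... | s , s∈S , z∈s = h s s∈S z z∈s

  Chain : Family → Set a
  Chain S = ∀ s t → IsTrue (S s) → IsTrue (S t) → s ⊑ t ⊎ t ⊑ s

  -- The subsets reached by iterating f transfinitely from ∅, taking unions at limits.
  module Tower (f : Subset → Subset) (f-extensive : ∀ x → x ⊑ f x) where

    data Reached : Subset → Set a where
      step  : ∀ {x} → Reached x → Reached (f x)
      union : ∀ S → (∀ s → IsTrue (S s) → Reached s) → Reached (⋃ S)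

    -- The extreme points of the Bourbaki-Witt argument: nothing reached strictly below `x` is
    -- carried past `x` by one step.
    Extreme : Subset → Set a
    Extreme x = ∀ {y} → Reached y → y ⊑ x → ¬ (x ⊑ y) → f y ⊑ x

    -- Induction on how `y` was reached. A step from strictly below `x` stays below by extremeness,
    -- and a step from `x` itself lands on `f x`. A union lies beyond as soon as one member does,
    -- and below otherwise.
    below-or-beyond : ∀ {x} → Extreme x → ∀ {y} → Reached y → y ⊑ x ⊎ f x ⊑ y
    below-or-beyond {x} ex (step {y} r) with below-or-beyond ex r
    ... | inj₂ fx⊑y = inj₂ (⊑-trans fx⊑y (f-extensive y))
    ... | inj₁ y⊑x with em {P = x ⊑ y}
    ...   | no x⋢y = inj₁ (ex r y⊑x x⋢y)
    ...   | yes x⊑y with ⊑-antisym x⊑y y⊑x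
    ...     | refl = inj₂ (λ _ → id)
    below-or-beyond {x} ex (union S r)
      with em {P = ∃[ s ] (IsTrue (S s) × f x ⊑ s)}
    ... | yes (s , s∈S , fx⊑s) = inj₂ (⊑-trans fx⊑s (⋃-upper S s∈S))
    ... | no none = inj₁ (⋃-least S below)
      where
      below : ∀ s → IsTrue (S s) → s ⊑ x
      below s s∈S with below-or-beyond ex (r s s∈S)
      ... | inj₁ s⊑x  = s⊑x
      ... | inj₂ fx⊑s = ⊥-elim (none (s , s∈S , fx⊑s))

    -- Induction on how `x` was reached. If `x` is a union and `y` is strictly below it, some member
    -- contains `y`, since otherwise every member would lie below `y`.
    extreme : ∀ {x} → Reached x → Extreme x
    extreme (step {x} r) {y} ry y⊑fx fx⋢y with below-or-beyond (extreme r) ry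
    ... | inj₂ fx⊑y = ⊥-elim (fx⋢y fx⊑y)
    ... | inj₁ y⊑x with em {P = x ⊑ y}
    ...   | no x⋢y = ⊑-trans (extreme r ry y⊑x x⋢y) (f-extensive x)
    ...   | yes x⊑y with ⊑-antisym x⊑y y⊑x
    ...     | refl = λ _ → id
    extreme (union S r) {y} ry y⊑⋃ ⋃⋢y
      with em {P = ∃[ s ] (IsTrue (S s) × y ⊑ s)}
    ... | no none = ⊥-elim (⋃⋢y (⋃-least S below))
      where
      below : ∀ s → IsTrue (S s) → s ⊑ y
      below s s∈S with below-or-beyond (extreme (r s s∈S)) ry
      ... | inj₁ y⊑s  = ⊥-elim (none (s , s∈S , y⊑s))
      ... | inj₂ fs⊑y = ⊑-trans (f-extensive s) fs⊑y
    ... | yes (s , s∈S , y⊑s) with em {P = s ⊑ y}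
    ...   | no s⋢y = ⊑-trans (extreme (r s s∈S) ry y⊑s s⋢y) (⋃-upper S s∈S)
    ...   | yes s⊑y with ⊑-antisym s⊑y y⊑s
    -- Extremeness of `s` concerns only sets strictly below `s`, and here `y` is `s`. Comparing the
    -- whole union with `s` gives the bound instead.
    ...     | refl with below-or-beyond (extreme (r s s∈S)) (union S r)
    ...       | inj₁ ⋃⊑y  = ⊥-elim (⋃⋢y ⋃⊑y)
    ...       | inj₂ fy⊑⋃ = fy⊑⋃

    reached-linear : ∀ {x y} → Reached x → Reached y → x ⊑ y ⊎ y ⊑ x
    reached-linear {x} rx ry with below-or-beyond (extreme rx) ry
    ... | inj₁ y⊑x  = inj₂ y⊑x
    ... | inj₂ fx⊑y = inj₁ (⊑-trans (f-extensive x) fx⊑y)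

    all-reached : Family
    all-reached x = isYes (em {P = Reached x})

    limit : Subset
    limit = ⋃ all-reached

    limit-reached : Reached limit
    limit-reached = union all-reached λ _ → toWitness

    -- The union of all reached sets is itself reached, so its image under `f` is one of the sets
    -- united.
    limit-closed : f limit ⊑ limit
    limit-closed = ⋃-upper all-reached (fromWitness (step limit-reached))

  -- The empty chain is included, so P holds of ∅ in particular.
  zorn : ∀ {p} (P : Pred Subset p) →
         (∀ S → Chain S → (∀ s → IsTrue (S s) → P s) → P (⋃ S)) →
         ∃[ m ] (P m × (∀ x → P x → m ⊑ x → x ⊑ m))
  zorn P P-⋃ = limit , reached-P limit-reached , maximal
    where
    Larger : Subset → Subset → Set _
    Larger x y = P y × x ⊑ y × ¬ (y ⊑ x)

    -- Deciding the existential type yields an actual `y`, so `em` doubles as the choice function.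
    f : Subset → Subset
    f x with em {P = ∃[ y ] Larger x y}
    ... | yes (y , _) = y
    ... | no _        = x

    f-extensive : ∀ x → x ⊑ f x
    f-extensive x with em {P = ∃[ y ] Larger x y}
    ... | yes (_ , _ , x⊑y , _) = x⊑y
    ... | no _                  = λ _ → id

    f-P : ∀ {x} → P x → P (f x)
    f-P {x} Px with em {P = ∃[ y ] Larger x y}
    ... | yes (_ , Py , _) = Py
    ... | no _             = Px

    f-fixed⇒maximal : ∀ {x} → f x ⊑ x → ∀ y → P y → x ⊑ y → y ⊑ x
    f-fixed⇒maximal {x} fx⊑x y Py x⊑y with em {P = ∃[ y ] Larger x y}
    ... | yes (_ , _ , _ , z⋢x) = ⊥-elim (z⋢x fx⊑x)
    ... | no none = decidable-stable em λ y⋢x → none (y , Py , x⊑y , y⋢x)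

    open Tower f f-extensive

    reached-P : ∀ {x} → Reached x → P x
    reached-P (step r)    = f-P (reached-P r)
    reached-P (union S r) =
      P-⋃ S (λ s t s∈S t∈S → reached-linear (r s s∈S) (r t t∈S))
            (λ s s∈S → reached-P (r s s∈S))

    maximal : ∀ x → P x → limit ⊑ x → x ⊑ limit
    maximal = f-fixed⇒maximal limit-closed

-- Filters, ideals and ultrafilters

module _ {c ℓ} (𝐀 : ConditionalAlgebra c ℓ) where
  open ConditionalAlgebra 𝐀
  open BooleanAlgebraProperties booleanAlgebra
    using (∨-∧-orderTheoreticLattice; ∨-identityʳ; ∨-identityˡ; ∧-identityʳ)
  open Order.Lattice ∨-∧-orderTheoreticLattice
    using (x∧y≤x; x∧y≤y; ∧-greatest; x≤x∨y; y≤x∨y; ∨-least; antisym)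
    renaming (refl to ≤-refl; trans to ≤-trans; reflexive to ≤-reflexive)
  open Filter using () renaming (set to ⟦_⟧)
  open Ultrafilter using () renaming (set to ⟦_⟧ᵘ)

  ≤-⊤ : ∀ {a} → a ≤ ⊤
  ≤-⊤ {a} = sym (∧-identityʳ a)

  ⊥-≤ : ∀ {a} → ⊥ ≤ a
  ⊥-≤ {a} = ≤-trans (y≤x∨y a ⊥) (≤-reflexive (∨-identityʳ a))

  ∨-monotonic : ∀ {a b x y} → a ≤ x → b ≤ y → a ∨ b ≤ x ∨ y
  ∨-monotonic p q = ∨-least (≤-trans p (x≤x∨y _ _)) (≤-trans q (y≤x∨y _ _))

  ∧-∨-interchange-≤ : ∀ {f g x y i j} → f ≤ x ∨ i → g ≤ y ∨ j →
                      f ∧ g ≤ (x ∧ y) ∨ (i ∨ j)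
  ∧-∨-interchange-≤ {x = x} {y} {i} {j} p q =
    ≤-trans (∧-greatest
              (≤-trans (x∧y≤x _ _) (≤-trans p (∨-monotonic ≤-refl (x≤x∨y i j))))
              (≤-trans (x∧y≤y _ _) (≤-trans q (∨-monotonic ≤-refl (y≤x∨y i j)))))
            (≤-reflexive (sym (∨-distribʳ-∧ (i ∨ j) x y)))

  record Ideal : Set (lsuc (c ⊔ ℓ)) where
    field
      set      : Pred Carrier (c ⊔ ℓ)
      ⊥-closed : ⊥ ∈ set
      ↓-closed : ∀ {a b} → a ≤ b → b ∈ set → a ∈ set
      ∨-closed : ∀ {a b} → a ∈ set → b ∈ set → a ∨ b ∈ set

  Disjoint : Filter 𝐀 → Ideal → Set (c ⊔ ℓ)
  Disjoint F I = ∀ {a} → a ∈ ⟦ F ⟧ → a ∉ Ideal.set I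

  ↑_ : Carrier → Filter 𝐀
  ↑ a = record
    { set      = λ x → Lift c (a ≤ x)
    ; ⊤-closed = lift ≤-⊤
    ; ↑-closed = λ { p (lift q) → lift (≤-trans q p) }
    ; ∧-closed = λ { (lift p) (lift q) → lift (∧-greatest p q) }
    }

  ↓_ : Carrier → Ideal
  ↓ a = record
    { set      = λ x → Lift c (x ≤ a)
    ; ⊥-closed = lift ⊥-≤
    ; ↓-closed = λ { p (lift q) → lift (≤-trans p q) }
    ; ∨-closed = λ { (lift p) (lift q) → lift (∨-least p q) }
    }

  disjoint-↓ : ∀ F {a} → a ∉ ⟦ F ⟧ → Disjoint F (↓ a)
  disjoint-↓ F a∉F x∈F (lift x≤a) = a∉F (Filter.↑-closed F x≤a x∈F)

  -- The filter generated by F and the complements of the elements of I.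
  _∖_ : Filter 𝐀 → Ideal → Filter 𝐀
  F ∖ I = record
    { set      = λ x → ∃[ f ] ∃[ i ] (f ∈ ⟦ F ⟧ × i ∈ I.set × f ≤ x ∨ i)
    ; ⊤-closed = ⊤ , ⊥ , F.⊤-closed , I.⊥-closed , x≤x∨y ⊤ ⊥
    ; ↑-closed = λ { p (f , i , f∈F , i∈I , q) →
        f , i , f∈F , i∈I , ≤-trans q (∨-monotonic p ≤-refl) }
    ; ∧-closed = λ { (f , i , f∈F , i∈I , p) (g , j , g∈F , j∈I , q) →
        f ∧ g , i ∨ j , F.∧-closed f∈F g∈F , I.∨-closed i∈I j∈I ,
        ∧-∨-interchange-≤ p q }
    }
    where
    module F = Filter F
    module I = Ideal I

  ∖-proper : ∀ F I → Disjoint F I → Proper 𝐀 (F ∖ I)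
  ∖-proper F I F∩I (f , i , f∈F , i∈I , f≤⊥∨i) =
    F∩I (Filter.↑-closed F (≤-trans f≤⊥∨i (≤-reflexive (∨-identityˡ i))) f∈F) i∈I

  -- If `a` is not in `u`, the elements whose join with `a` lies in `u` form a proper filter that
  -- extends `u` and contains `b`; maximality puts `b` in `u`.
  ultrafilter-prime : (∀ {a} → ExcludedMiddle a) → ∀ (u : Ultrafilter 𝐀) {a b} →
                      a ∨ b ∈ ⟦ u ⟧ᵘ → a ∈ ⟦ u ⟧ᵘ ⊎ b ∈ ⟦ u ⟧ᵘ
  ultrafilter-prime em u {a} {b} a∨b∈u with em {P = a ∈ ⟦ u ⟧ᵘ}
  ... | yes a∈u = inj₁ a∈u
  ... | no a∉u  = inj₂ (U.maximal u∶a proper (U.↑-closed (y≤x∨y a _)) a∨b∈u)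
    where
    module U = Ultrafilter u

    u∶a : Filter 𝐀
    u∶a = record
      { set      = λ x → a ∨ x ∈ ⟦ u ⟧ᵘ
      ; ⊤-closed = U.↑-closed (y≤x∨y a ⊤) U.⊤-closed
      ; ↑-closed = λ p → U.↑-closed (∨-monotonic ≤-refl p)
      ; ∧-closed = λ {x} {y} p q →
          U.↑-closed (≤-reflexive (sym (∨-distribˡ-∧ a x y))) (U.∧-closed p q)
      }

    proper : Proper 𝐀 u∶a
    proper = a∉u ∘ U.↑-closed (≤-reflexive (∨-identityʳ a))

  -- Monotonicity of the conditional and the sets `D`

  ⇒-monoʳ : ∀ {a b d} → b ≤ d → a ⇒ b ≤ a ⇒ d
  ⇒-monoʳ {a} {b} {d} b≤d =
    -- `b ≤ d` is by definition the equation `b ≈ b ∧ d`, so congruence applies to it directly.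
    ≤-trans (≤-reflexive (⇒-cong refl b≤d))
      (≤-trans (≤-reflexive (sym (⇒-∧ a b d))) (x∧y≤y _ _))

  ⇒-antiˡ : ∀ {a b d} → a ≤ b → b ⇒ d ≤ a ⇒ d
  ⇒-antiˡ {a} {b} {d} a≤b =
    ≤-trans (≤-reflexive (⇒-cong b≈a∨b refl)) (≤-trans (∨-⇒ a b d) (x∧y≤x _ _))
    where
    b≈a∨b : b ≈ a ∨ b
    b≈a∨b = antisym (y≤x∨y a b) (∨-least a≤b ≤-refl)

  -- A description of `D 𝐀 u (↑ e)` without the existential, packaged as a filter so that separation
  -- can be applied to it.
  consequents : Ultrafilter 𝐀 → Carrier → Filter 𝐀
  consequents u e = record
    { set      = λ d → e ⇒ d ∈ ⟦ u ⟧ᵘ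
    ; ⊤-closed = U.↑-closed (≤-reflexive (sym (⇒-⊤ e))) U.⊤-closed
    ; ↑-closed = U.↑-closed ∘ ⇒-monoʳ
    ; ∧-closed = λ p q → U.↑-closed (≤-reflexive (⇒-∧ e _ _)) (U.∧-closed p q)
    }
    where module U = Ultrafilter u

  D-↑ : ∀ u e → D 𝐀 u (↑ e) ⊆ ⟦ consequents u e ⟧
  D-↑ u e (a , lift e≤a , a⇒b∈u) = Ultrafilter.↑-closed u (⇒-antiˡ e≤a) a⇒b∈u

  -- Existence and separation by ultrafilters

  module Classical (em : ∀ {a} → ExcludedMiddle a)
                   (ext : ∀ {a b} → Extensionality a b) where

    open Zorn em ext {A = Carrier}

    ultrafilter-extension : ∀ F → Proper 𝐀 F → ∃[ u ] (u ∈ φ 𝐀 F)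
    ultrafilter-extension F F-proper =
      let m , (G , G-proper , G⊆ , ⊆G) , m-maximal = zorn Good Good-⋃ in
      record
        { filter  = G
        ; proper  = G-proper
        -- A proper filter `H` above `G` contains `F`, so adjoining `F` to its Bool-valued copy
        -- gives back `H`. That copy is therefore good and competes with `m`.
        ; maximal = λ H H-proper G⊆H z∈H →
            ⊆G (inj₂ (m-maximal (compr ⟦ H ⟧)
              (H , H-proper , inj₂ ∘ ∈-compr⁺ ⟦ H ⟧ ,
                λ { (inj₁ z∈F) → G⊆H (⊆G (inj₁ z∈F)) ; (inj₂ z∈H) → ∈-compr⁻ ⟦ H ⟧ z∈H })
              (λ _ z∈m → ∈-compr⁺ ⟦ H ⟧ (G⊆H (⊆G (inj₂ z∈m)))) _ (∈-compr⁺ ⟦ H ⟧ z∈H)))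
        } , ⊆G ∘ inj₁
      where
      module F = Filter F

      -- F is adjoined so that the union of the empty chain is good as well.
      F∪_ : Subset → Pred Carrier (c ⊔ ℓ)
      F∪ x = ⟦ F ⟧ ∪ (_∈ˢ x)

      -- `zorn` ranges over Bool-valued subsets only, so a filter enters through a subset that
      -- determines it once `F` is adjoined.
      Good : Pred Subset _
      Good x = ∃[ G ] (Proper 𝐀 G × ⟦ G ⟧ ≐ F∪ x)

      F∪-mono : ∀ {x y} → x ⊑ y → F∪ x ⊆ F∪ y
      F∪-mono x⊑y (inj₁ z∈F) = inj₁ z∈F
      F∪-mono x⊑y (inj₂ z∈x) = inj₂ (x⊑y _ z∈x)

      good-↑ : ∀ {x a b} → Good x → a ≤ b → a ∈ F∪ x → b ∈ F∪ x
      good-↑ (G , _ , G⊆ , ⊆G) a≤b = G⊆ ∘ Filter.↑-closed G a≤b ∘ ⊆G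

      good-∧ : ∀ {x a b} → Good x → a ∈ F∪ x → b ∈ F∪ x → a ∧ b ∈ F∪ x
      good-∧ (G , _ , G⊆ , ⊆G) a∈ b∈ = G⊆ (Filter.∧-closed G (⊆G a∈) (⊆G b∈))

      Good-⋃ : ∀ S → Chain S → (∀ s → IsTrue (S s) → Good s) → Good (⋃ S)
      Good-⋃ S chain good = U , U-proper , id , id
        where
        into : ∀ {s} → IsTrue (S s) → F∪ s ⊆ F∪ (⋃ S)
        into s∈S = F∪-mono (⋃-upper S s∈S)

        ↑-cl : ∀ {a b} → a ≤ b → a ∈ F∪ (⋃ S) → b ∈ F∪ (⋃ S)
        ↑-cl a≤b (inj₁ a∈F) = inj₁ (F.↑-closed a≤b a∈F)
        ↑-cl a≤b (inj₂ a∈⋃) with ∈-⋃⁻ S a∈⋃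
        ... | s , s∈S , a∈s = into s∈S (good-↑ (good s s∈S) a≤b (inj₂ a∈s))

        ∧-cl : ∀ {a b} → a ∈ F∪ (⋃ S) → b ∈ F∪ (⋃ S) → a ∧ b ∈ F∪ (⋃ S)
        ∧-cl (inj₁ a∈F) (inj₁ b∈F) = inj₁ (F.∧-closed a∈F b∈F)
        ∧-cl (inj₁ a∈F) (inj₂ b∈⋃) with ∈-⋃⁻ S b∈⋃
        ... | t , t∈S , b∈t = into t∈S (good-∧ (good t t∈S) (inj₁ a∈F) (inj₂ b∈t))
        ∧-cl (inj₂ a∈⋃) (inj₁ b∈F) with ∈-⋃⁻ S a∈⋃
        ... | s , s∈S , a∈s = into s∈S (good-∧ (good s s∈S) (inj₂ a∈s) (inj₁ b∈F))
        ∧-cl (inj₂ a∈⋃) (inj₂ b∈⋃) with ∈-⋃⁻ S a∈⋃ | ∈-⋃⁻ S b∈⋃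
        -- The larger of the two members contains both elements, hence their meet.
        ... | s , s∈S , a∈s | t , t∈S , b∈t with chain s t s∈S t∈S
        ...   | inj₁ s⊑t =
                  into t∈S (good-∧ (good t t∈S) (inj₂ (s⊑t _ a∈s)) (inj₂ b∈t))
        ...   | inj₂ t⊑s =
                  into s∈S (good-∧ (good s s∈S) (inj₂ a∈s) (inj₂ (t⊑s _ b∈t)))

        U : Filter 𝐀
        U = record
          { set      = F∪ (⋃ S)
          ; ⊤-closed = inj₁ F.⊤-closed
          ; ↑-closed = ↑-cl
          ; ∧-closed = ∧-cl
          }

        U-proper : Proper 𝐀 U
        U-proper (inj₁ ⊥∈F) = F-proper ⊥∈F
        U-proper (inj₂ ⊥∈⋃) with ∈-⋃⁻ S ⊥∈⋃
        ... | s , s∈S , ⊥∈s with good s s∈S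
        ...   | _ , G-proper , _ , ⊆G = G-proper (⊆G (inj₂ ⊥∈s))

    -- An ultrafilter above `F ∖ I` contains `F` and the complement of each element of `I`, so an
    -- element of `I` in it would force `⊥` into it.
    separation : ∀ F I → Disjoint F I →
                 ∃[ w ] (w ∈ φ 𝐀 F × Disjoint (Ultrafilter.filter w) I)
    separation F I F∩I = w , F⊆w , w∩I
      where
      extension = ultrafilter-extension (F ∖ I) (∖-proper F I F∩I)
      w = proj₁ extension
      module W = Ultrafilter w

      F⊆w : w ∈ φ 𝐀 F
      F⊆w {f} f∈F = proj₂ extension (f , ⊥ , f∈F , Ideal.⊥-closed I , x≤x∨y f ⊥)

      w∩I : Disjoint W.filter I
      w∩I {i} i∈w i∈I = W.proper (W.↑-closed (≤-reflexive (∧-complementʳ i))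
        (W.∧-closed i∈w (proj₂ extension
          -- These witnesses put the complement of `i` into `F ∖ I`, since its join with `i` is `⊤`.
          (⊤ , i , Filter.⊤-closed F , i∈I , ≤-reflexive (sym (∨-complementˡ i))))))

    avoid : ∀ F {a} → a ∉ ⟦ F ⟧ → ∃[ w ] (w ∈ φ 𝐀 F × a ∉ ⟦ w ⟧ᵘ)
    avoid F {a} a∉F with separation F (↓ a) (disjoint-↓ F a∉F)
    ... | w , F⊆w , w∩↓a = w , F⊆w , λ a∈w → w∩↓a a∈w (lift ≤-refl)

    ≤-from-ultrafilters : ∀ {a b} → (∀ u → a ∈ ⟦ u ⟧ᵘ → b ∈ ⟦ u ⟧ᵘ) → a ≤ b
    ≤-from-ultrafilters {a} {b} h = decidable-stable em λ a≰b →
      let u , ↑a⊆u , b∉u = avoid (↑ a) (λ { (lift a≤b) → a≰b a≤b })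
      in b∉u (h u (↑a⊆u (lift ≤-refl)))

    -- Singletons as sets of the form `φ F`

    φ-singleton : ∀ w → ｛_｝ 𝐀 w ≐ φ 𝐀 (Ultrafilter.filter w)
    φ-singleton w = proj₁ , λ {v} w⊆v →
      w⊆v , Ultrafilter.maximal w (Ultrafilter.filter v) (Ultrafilter.proper v) w⊆v

    -- The filter witnessing `T` at a singleton is arbitrary. An element of `w` missing from `G`
    -- would be avoided by some ultrafilter above `G`, but the only such ultrafilter is `w`.
    singleton-φ⇒⊇ : ∀ G w → ｛_｝ 𝐀 w ≐ φ 𝐀 G → ⟦ w ⟧ᵘ ⊆ ⟦ G ⟧
    singleton-φ⇒⊇ G w (_ , φG⊆) a∈w = decidable-stable em λ a∉G →
      let w′ , G⊆w′ , a∉w′ = avoid G a∉G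
      in a∉w′ (proj₁ (φG⊆ {w′} G⊆w′) a∈w)

    HasPoint : Set _
    HasPoint = ∀ (u v : Ultrafilter 𝐀) (Y : Pred (Ultrafilter 𝐀) (c ⊔ ℓ)) →
      T 𝐀 u Y v → ∃[ w ] (w ∈ Y × T 𝐀 u (｛_｝ 𝐀 w) v)

    -- From the axioms to the point

    module _ (ps : IsPseudoSubordination 𝐀) where
      open IsPseudoSubordination ps

      refuted : Ultrafilter 𝐀 → Ultrafilter 𝐀 → Ideal
      refuted u v = record
        { set      = λ a → ∃[ b ] (b ∉ ⟦ v ⟧ᵘ × a ⇒ b ∈ ⟦ u ⟧ᵘ)
        ; ⊥-closed = ⊥ , V.proper , U.↑-closed (≤-reflexive (sym (⊥-⇒ ⊥))) U.⊤-closed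
        ; ↓-closed = λ { a≤a′ (b , b∉v , p) → b , b∉v , U.↑-closed (⇒-antiˡ a≤a′) p }
        -- The two arrows are first weakened to the common consequent `b ∨ b′`, which stays outside
        -- `v` because `v` is prime.
        ; ∨-closed = λ { (b , b∉v , p) (b′ , b′∉v , p′) →
            b ∨ b′ , ∨-∉ b∉v b′∉v ,
            U.↑-closed (⇒-∨ _ _ _)
              (U.∧-closed (U.↑-closed (⇒-monoʳ (x≤x∨y b b′)) p)
                          (U.↑-closed (⇒-monoʳ (y≤x∨y b b′)) p′)) }
        }
        where
        module U = Ultrafilter u
        module V = Ultrafilter v

        ∨-∉ : ∀ {b b′} → b ∉ ⟦ v ⟧ᵘ → b′ ∉ ⟦ v ⟧ᵘ → b ∨ b′ ∉ ⟦ v ⟧ᵘ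
        ∨-∉ b∉v b′∉v = [ b∉v , b′∉v ] ∘ ultrafilter-prime em v

      pseudoSubordination⇒hasPoint : HasPoint
      pseudoSubordination⇒hasPoint u v Y (F , (_ , φF⊆Y) , D⊆v)
        with separation F (refuted u v)
               (λ a∈F (b , b∉v , a⇒b∈u) → b∉v (D⊆v (_ , a∈F , a⇒b∈u)))
      ... | w , F⊆w , w∩I =
        w , φF⊆Y {w} F⊆w , Ultrafilter.filter w , φ-singleton w ,
        -- With `w` itself as the filter, inclusion of `D` in `v` is disjointness from
        -- `refuted u v`, up to double negation.
        λ { (a , a∈w , a⇒b∈u) → decidable-stable em λ b∉v →
              w∩I a∈w (_ , b∉v , a⇒b∈u) }

    -- From the point to the axioms

    module _ (hasPoint : HasPoint) where

      -- Some `v` extends `consequents u e` and omits `b`, so `T` relates `u` to `v` at `φ 𝐀 (↑ e)`.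
      -- For the point `w` obtained there, an `a` in `w` with `a ⇒ b` in `u` would put `b` into `v`.
      point-above : ∀ u e b → e ⇒ b ∉ ⟦ u ⟧ᵘ →
                    ∃[ w ] (e ∈ ⟦ w ⟧ᵘ × (∀ {a} → a ∈ ⟦ w ⟧ᵘ → a ⇒ b ∉ ⟦ u ⟧ᵘ))
      point-above u e b e⇒b∉u with avoid (consequents u e) e⇒b∉u
      ... | v , ⊆v , b∉v
        with hasPoint u v (φ 𝐀 (↑ e)) (↑ e , (id , id) , ⊆v ∘ D-↑ u e)
      ...   | w , ↑e⊆w , G , ｛w｝≐φG , D⊆v =
        w , ↑e⊆w (lift ≤-refl) ,
        λ a∈w a⇒b∈u → b∉v (D⊆v (_ , singleton-φ⇒⊇ G w ｛w｝≐φG a∈w , a⇒b∈u))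

      hasPoint⇒pseudoSubordination : IsPseudoSubordination 𝐀
      hasPoint⇒pseudoSubordination = record
        { ⊥-⇒ = λ a → antisym ≤-⊤ (≤-from-ultrafilters λ u _ →
            decidable-stable em λ ⊥⇒a∉u →
              let w , ⊥∈w , _ = point-above u ⊥ a ⊥⇒a∉u in Ultrafilter.proper w ⊥∈w)
        ; ⇒-∨ = λ a b d → ≤-from-ultrafilters λ u both∈u →
            decidable-stable em λ a∨b⇒d∉u →
              let w , a∨b∈w , ⇒d∉u = point-above u (a ∨ b) d a∨b⇒d∉u
              in [ (λ a∈w → ⇒d∉u a∈w (Ultrafilter.↑-closed u (x∧y≤x _ _) both∈u))
                 , (λ b∈w → ⇒d∉u b∈w (Ultrafilter.↑-closed u (x∧y≤y _ _) both∈u))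
                 ] (ultrafilter-prime em w a∨b∈w)
        }

theorem9p4 : (∀ {a} → ExcludedMiddle a) → (∀ {a b} → Extensionality a b) →
    ∀ {c ℓ} (𝐀 : ConditionalAlgebra c ℓ) →
    IsPseudoSubordination 𝐀 ⇔
    (∀ (u v : Ultrafilter 𝐀) (Y : Pred (Ultrafilter 𝐀) (c ⊔ ℓ)) →
    T 𝐀 u Y v → ∃[ w ] (w ∈ Y × T 𝐀 u (｛_｝ 𝐀 w) v))
theorem9p4 em ext 𝐀 = mk⇔ pseudoSubordination⇒hasPoint hasPoint⇒pseudoSubordination
  where open Classical 𝐀 em ext
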